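{- Let $G$ be a finite $2$-connected outerplanar graph. Then determining sets fail to have the exchange property in $G$ if and only if $G$ contains a vertex that is moved by every reflection in $\mathrm{Aut}(G)$ and also contains two vertices that are fixed by different reflections in $\mathrm{Aut}(G)$.
   Context: A set $S\subseteq V(G)$ is a determining set if the only automorphism of $G$ fixing every vertex of $S$ is the identity; it is minimal if no proper subset is a determining set. Determining sets have the exchange property in $G$ if whenever $S,R$ are minimal determining sets and $r\in R$, there is $s\in S$ such that $(S\setminus\{s\})\cup\{r\}$ is a minimal determining set. A $2$-connected outerplanar graph with at least three vertices has a unique Hamilton cycle, which every automorphism preserves, so every automorphism acts on this cycle as an element of the dihedral group (a rotation or a reflection of the cycle); a reflection of $G$ means a nonidentity automorphism acting as a reflection of the Hamilton cycle. When $G=K_2$, its unique nontrivial automorphism is regarded as a reflection. Only nontrivial reflections are considered. -}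

module Defs where

open import Data.Nat using (ℕ; zero; suc; _+_; _∸_; _<_; _≤_; _%_)
open import Data.Nat.DivMod using (m%n<n)
open import Data.Fin using (Fin; toℕ; fromℕ<)
open import Data.Fin.Subset using (Subset; _∈_; _⊂_; _∪_; _-_; ⁅_⁆)
open import Data.Fin.Permutation using (Permutation′; _⟨$⟩ʳ_)
open import Data.Bool using (Bool; true; false)
open import Data.Product using (Σ; ∃; _×_)
open import Data.Empty using (⊥)
open import Data.Unit using (⊤)
open import Relation.Nullary using (¬_)
open import Relation.Binary.PropositionalEquality using (_≡_; _≢_)

record Graph (n : ℕ) : Set where
  field
    adj    : Fin n → Fin n → Bool
    adj-sym : ∀ u v → adj u v ≡ adj v u
    adj-irr : ∀ v → adj v v ≡ false
open Graph public

module _ {n : ℕ} (G : Graph n) where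

  data Walk (P : Fin n → Set) : Fin n → Fin n → Set where
    here : ∀ {u} → P u → Walk P u u
    step : ∀ {u v w} → P u → adj G u v ≡ true → Walk P v w → Walk P u w

  Connected : Set
  Connected = ∀ u v → Walk (λ _ → ⊤) u v

  -- 2-connected: at least two vertices, connected, and deleting any single
  -- vertex leaves a connected graph (so K₂ counts as 2-connected).
  TwoConnected : Set
  TwoConnected = 2 ≤ n × Connected
    × (∀ x u v → u ≢ x → v ≢ x → Walk (λ w → w ≢ x) u v)

  -- Outerplanarity: the vertices can be placed on a circle (positions
  -- given by the bijection p) so that no two edges cross as chords.

  Interleave : Fin n → Fin n → Fin n → Fin n → Set
  Interleave x y z w = toℕ x < toℕ z × toℕ z < toℕ y × toℕ y < toℕ w

  Outerplanar : Set
  Outerplanar = Σ (Permutation′ n) λ p →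
    ∀ a b c d → adj G a b ≡ true → adj G c d ≡ true →
      ¬ Interleave (p ⟨$⟩ʳ a) (p ⟨$⟩ʳ b) (p ⟨$⟩ʳ c) (p ⟨$⟩ʳ d)

  IsAut : Permutation′ n → Set
  IsAut σ = ∀ u v → adj G (σ ⟨$⟩ʳ u) (σ ⟨$⟩ʳ v) ≡ adj G u v

  IsIdentity : Permutation′ n → Set
  IsIdentity σ = ∀ v → σ ⟨$⟩ʳ v ≡ v

  Determining : Subset n → Set
  Determining S = ∀ σ → IsAut σ → (∀ v → v ∈ S → σ ⟨$⟩ʳ v ≡ v) → IsIdentity σ

  MinimalDetermining : Subset n → Set
  MinimalDetermining S = Determining S × (∀ T → T ⊂ S → ¬ Determining T)

  ExchangeProperty : Set
  ExchangeProperty = ∀ S R → MinimalDetermining S → MinimalDetermining R →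
    ∀ r → r ∈ R → ∃ λ s → s ∈ S × MinimalDetermining ((S - s) ∪ ⁅ r ⁆)

modF : ∀ {m} → ℕ → Fin (suc m)
modF {m} k = fromℕ< (m%n<n k (suc m))

-- h lists the vertices in cyclic order (position i ↦ vertex h i) and
-- consecutive vertices (cyclically) are adjacent.
IsHamiltonCycle : ∀ {m} → Graph (suc m) → Permutation′ (suc m) → Set
IsHamiltonCycle {m} G h =
  ∀ (i : Fin (suc m)) → adj G (h ⟨$⟩ʳ i) (h ⟨$⟩ʳ modF (suc (toℕ i))) ≡ true

reflectPos : ∀ {m} → Fin (suc m) → Fin (suc m) → Fin (suc m)
reflectPos {m} k i = modF (toℕ k + (suc m ∸ toℕ i))

ActsAsReflection : ∀ {m} → Permutation′ (suc m) → Permutation′ (suc m) → Set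
ActsAsReflection h σ = ∃ λ k → ∀ i → σ ⟨$⟩ʳ (h ⟨$⟩ʳ i) ≡ h ⟨$⟩ʳ reflectPos k i

-- A reflection of G: a nonidentity automorphism acting as a reflection of a
-- Hamilton cycle of G.  (For K₂ this is exactly its nontrivial automorphism.)
IsReflection : ∀ {n} → Graph n → Permutation′ n → Set
IsReflection {zero}  G σ = ⊥
IsReflection {suc m} G σ = IsAut G σ × ¬ IsIdentity G σ
  × ∃ λ h → IsHamiltonCycle G h × ActsAsReflection h σ

{-# OPTIONS --safe #-}

-- Deleting a vertex shows that vertices neighbouring each other on the circle
-- of a noncrossing placement are adjacent, so the circle is a Hamilton cycle.
-- A chord of a placement separates its two sides, hence two placements with the
-- same first vertex agree up to reversal; comparing a placement with its
-- composite with an automorphism, every vertex stabiliser is trivial or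
-- generated by one reflection.  Minimal determining sets are then single
-- vertices moved by all reflections or pairs fixed by different reflections,
-- or empty if Aut(G) is trivial, and exchange fails exactly when both of the
-- first two kinds occur.
module Submission where

open import Defs
open import Data.Nat using (zero; suc; z≤n; s≤s; _∸_)
import Data.Nat as ℕ
import Data.Nat.Properties as ℕ
open import Data.Nat.DivMod using (m%n<n; m<n⇒m%n≡m; n%n≡0)
open import Data.Fin using (Fin; zero; suc; toℕ; fromℕ; inject₁; opposite; _<_)
open import Data.Fin.Properties
  using (_≟_; _<?_; <-cmp; any?; all?; suc-injective; toℕ-injective; toℕ-fromℕ; toℕ-fromℕ<;
    toℕ-inject₁; toℕ<n; ≤fromℕ; fromℕ≢inject₁; opposite-prop; opposite-involutive)
open import Data.Fin.Permutation
  using (Permutation′; _⟨$⟩ʳ_; _⟨$⟩ˡ_; permutation; inverseˡ; inverseʳ; flip; _∘ₚ_; _≈_)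
open import Data.Fin.Subset
  using (Subset; inside; outside; _∈_; _∉_; _⊆_; _⊂_; _∪_; _─_; _-_; ⁅_⁆) renaming (⊥ to ∅)
open import Data.Fin.Subset.Properties
  using (_∈?_; ∉⊥; ⊥⊆; x∈⁅x⁆; x∈⁅y⁆⇒x≡y; x∈p∪q⁺; x∈p∪q⁻; p─q⊆p; x∈p∧x≢y⇒x∈p-y)
open import Data.Vec.Base using (_∷_; there)
open import Data.Product using (∃; _×_; _,_; proj₁; proj₂)
open import Data.Sum using (_⊎_; inj₁; inj₂)
import Data.Sum as Sum
open import Data.Bool using (true)
import Data.Bool.Properties as Bool
open import Relation.Nullary using (¬_; Dec; yes; no; contradiction)
open import Relation.Nullary.Decidable using (_×-dec_; ¬?; decidable-stable)
open import Relation.Binary.Definitions using (tri<; tri≈; tri>)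
open import Relation.Unary using (Decidable)
open import Relation.Binary.PropositionalEquality
  using (_≡_; _≢_; refl; sym; trans; cong; cong₂; subst; subst₂; module ≡-Reasoning)
open import Function.Base using (_∘_)
open import Function.Bundles using (_⇔_; mk⇔)

⟨$⟩ʳ-injective : ∀ {n} (π : Permutation′ n) {x y} → π ⟨$⟩ʳ x ≡ π ⟨$⟩ʳ y → x ≡ y
⟨$⟩ʳ-injective π e = trans (sym (inverseˡ π)) (trans (cong (π ⟨$⟩ˡ_) e) (inverseˡ π))

-- The cyclic order on positions

prev : ∀ {m} → Fin (suc m) → Fin (suc m)
prev zero    = fromℕ _
prev (suc i) = inject₁ i

neg : ∀ {m} → Fin (suc m) → Fin (suc m)
neg zero    = zero
neg (suc i) = suc (opposite i)

neg-involutive : ∀ {m} (i : Fin (suc m)) → neg (neg i) ≡ i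
neg-involutive zero    = refl
neg-involutive (suc i) = cong suc (opposite-involutive i)

opposite-inject₁ : ∀ {m} (i : Fin m) → opposite (inject₁ i) ≡ suc (opposite i)
opposite-inject₁ i = begin
  opposite (inject₁ i)                       ≡⟨ cong (λ j → opposite (inject₁ j)) (opposite-involutive i) ⟨
  opposite (opposite (suc (opposite i)))     ≡⟨ opposite-involutive (suc (opposite i)) ⟩
  suc (opposite i)                           ∎
  where open ≡-Reasoning

-- This is the dihedral relation between a rotation and a reflection. It supplies the inverse of
-- `prev` and makes `neg` preserve `Consecutive`.
prev-neg-prev : ∀ {m} (i : Fin (suc m)) → prev (neg (prev i)) ≡ neg i
prev-neg-prev {zero}  zero          = refl
prev-neg-prev {suc m} zero          = cong inject₁ (opposite-involutive {suc m} zero)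
prev-neg-prev {suc m} (suc zero)    = refl
prev-neg-prev {suc m} (suc (suc i)) = cong inject₁ (opposite-inject₁ i)

neg-permutation : ∀ {m} → Permutation′ (suc m)
neg-permutation = permutation neg neg neg-involutive neg-involutive

prev-permutation : ∀ {m} → Permutation′ (suc m)
prev-permutation = permutation prev (λ i → neg (prev (neg i)))
  (λ i → trans (prev-neg-prev (neg i)) (neg-involutive i))
  (λ i → trans (cong neg (prev-neg-prev i)) (neg-involutive i))

toℕ-modF : ∀ {m} {k} → k ℕ.< suc m → toℕ (modF {m} k) ≡ k
toℕ-modF {m} {k} k<1+m = trans (toℕ-fromℕ< (m%n<n k (suc m))) (m<n⇒m%n≡m k<1+m)

modF-self : ∀ {m} → modF {m} (suc m) ≡ zero
modF-self {m} = toℕ-injective (trans (toℕ-fromℕ< (m%n<n (suc m) (suc m))) (n%n≡0 (suc m)))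

modF-suc-prev : ∀ {m} (i : Fin (suc m)) → modF (suc (toℕ (prev i))) ≡ i
modF-suc-prev {m} zero    = trans (cong (λ k → modF (suc k)) (toℕ-fromℕ m)) modF-self
modF-suc-prev     (suc i) = toℕ-injective (begin
  toℕ (modF (suc (toℕ (inject₁ i))))  ≡⟨ cong (λ k → toℕ (modF (suc k))) (toℕ-inject₁ i) ⟩
  toℕ (modF (suc (toℕ i)))            ≡⟨ toℕ-modF (s≤s (toℕ<n i)) ⟩
  suc (toℕ i)                         ∎)
  where open ≡-Reasoning

-- The two-sided inverse law follows from the one-sided `modF-suc-prev`, because `prev` is
-- surjective and `i` can be written as `prev j`.
prev-modF-suc : ∀ {m} (i : Fin (suc m)) → prev (modF (suc (toℕ i))) ≡ i
prev-modF-suc i = begin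
  prev (modF (suc (toℕ i)))         ≡⟨ cong (λ j → prev (modF (suc (toℕ j)))) i≡ ⟨
  prev (modF (suc (toℕ (prev j))))  ≡⟨ cong prev (modF-suc-prev j) ⟩
  prev j                            ≡⟨ i≡ ⟩
  i                                 ∎
  where
  open ≡-Reasoning
  j = prev-permutation ⟨$⟩ˡ i
  i≡ : prev j ≡ i
  i≡ = inverseʳ prev-permutation

neg≡reflectPos : ∀ {m} (i : Fin (suc m)) → neg i ≡ reflectPos zero i
neg≡reflectPos zero            = sym modF-self
neg≡reflectPos {suc m} (suc i) = toℕ-injective (begin
  suc (toℕ (opposite i))       ≡⟨ cong suc (opposite-prop i) ⟩
  suc (m ∸ toℕ i)              ≡⟨ ℕ.+-∸-assoc 1 (ℕ.≤-pred (toℕ<n i)) ⟨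
  suc m ∸ toℕ i                ≡⟨ toℕ-modF (s≤s (ℕ.m∸n≤m (suc m) (toℕ i))) ⟨
  toℕ (modF (suc m ∸ toℕ i))   ∎)
  where open ≡-Reasoning

Consecutive : ∀ {m} → Fin (suc m) → Fin (suc m) → Set
Consecutive i j = prev j ≡ i ⊎ prev i ≡ j

neg-consecutive : ∀ {m} {i j : Fin (suc m)} → Consecutive i j → Consecutive (neg i) (neg j)
neg-consecutive {i = i} {j} = Sum.swap ∘ Sum.map (λ { refl → prev-neg-prev j }) (λ { refl → prev-neg-prev i })

module _ {m} (g : Fin (suc (suc m)) → Fin (suc (suc m)))
  (g-injective : ∀ {i j} → g i ≡ g j → i ≡ j) (g-zero : g zero ≡ zero)
  (g-consecutive : ∀ i → Consecutive (g (inject₁ i)) (g (suc i))) where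

  -- An injective map cannot turn back on the cycle: once two successive positions are fixed, the
  -- next value is one of the two neighbours of the later one, and the other neighbour is already
  -- taken.
  consecutive∧one⇒identity : g (suc zero) ≡ suc zero → ∀ i → g i ≡ i
  consecutive∧one⇒identity g-one = λ { zero → g-zero ; (suc i) → proj₂ (go (toℕ i) i refl) }
    where
    -- The induction runs on the value `k`, since `inject₁ j` is not structurally smaller than
    -- `suc j`.
    go : ∀ k (i : Fin (suc m)) → toℕ i ≡ k → g (inject₁ i) ≡ inject₁ i × g (suc i) ≡ suc i
    go _       zero    _ = g-zero , g-one
    go (suc k) (suc j) e = proj₂ below , advance (g-consecutive (suc j))
      where
      below : g (inject₁ (inject₁ j)) ≡ inject₁ (inject₁ j) × g (suc (inject₁ j)) ≡ suc (inject₁ j)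
      below = go k (inject₁ j) (trans (toℕ-inject₁ j) (ℕ.suc-injective e))
      advance : Consecutive (g (suc (inject₁ j))) (g (suc (suc j))) → g (suc (suc j)) ≡ suc (suc j)
      advance (inj₁ e₁) = ⟨$⟩ʳ-injective prev-permutation (trans e₁ (proj₂ below))
      advance (inj₂ e₂) = contradiction (cong toℕ same) λ e′ →
          ℕ.m≢1+m+n (toℕ j) {1} (trans (sym (trans (toℕ-inject₁ (inject₁ j)) (toℕ-inject₁ j))) (trans e′ (cong suc (ℕ.+-comm 1 (toℕ j)))))
        where
        same : inject₁ (inject₁ j) ≡ suc (suc j)
        same = g-injective (trans (proj₁ below) (trans (cong prev (sym (proj₂ below))) e₂))

-- The image of position one is a neighbour of zero. If it is the last position, composing with
-- `neg` reduces to the case where it is one.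
consecutive⇒identity∨neg : ∀ {m} (g : Fin (suc (suc m)) → Fin (suc (suc m))) →
  (∀ {i j} → g i ≡ g j → i ≡ j) → g zero ≡ zero →
  (∀ i → Consecutive (g (inject₁ i)) (g (suc i))) →
  (∀ i → g i ≡ i) ⊎ (∀ i → g i ≡ neg i)
consecutive⇒identity∨neg {m} g g-injective g-zero g-consecutive with g-consecutive zero
... | inj₁ e = inj₁ (consecutive∧one⇒identity g g-injective g-zero g-consecutive
                 (⟨$⟩ʳ-injective prev-permutation (trans e g-zero)))
... | inj₂ e = inj₂ λ i → trans (sym (neg-involutive (g i))) (cong neg (neg∘g≗id i))
  where
  neg∘g≗id : ∀ i → neg (g i) ≡ i
  neg∘g≗id = consecutive∧one⇒identity (λ i → neg (g i))
    (λ e → g-injective (⟨$⟩ʳ-injective neg-permutation e)) (cong neg g-zero)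
    (λ i → neg-consecutive (g-consecutive i))
    (trans (cong neg (trans (sym e) (cong prev g-zero))) (cong suc (opposite-involutive {suc m} zero)))

-- The only change of order under `prev` is that zero becomes last, so zero can appear only on the
-- larger side.
prev-<⁻ : ∀ {m} {i j : Fin (suc m)} → prev i < prev j → toℕ i ≢ 0 × (i < j ⊎ j ≡ zero)
prev-<⁻ {i = zero} {j} l        = contradiction (≤fromℕ (prev j)) (ℕ.<⇒≱ l)
prev-<⁻ {i = suc i} {zero}  l   = (λ ()) , inj₂ refl
prev-<⁻ {i = suc i} {suc j} l   = (λ ()) , inj₁ (s≤s (subst₂ ℕ._<_ (toℕ-inject₁ i) (toℕ-inject₁ j) l))

prev-between : ∀ {m} {i j : Fin (suc m)} → i < j → prev j ≢ i → i < prev j × prev j < j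
prev-between {i = i} {suc j} (s≤s i≤j) j≢i =
  ℕ.≤∧≢⇒< (subst (toℕ i ℕ.≤_) (sym (toℕ-inject₁ j)) i≤j) (λ e → j≢i (sym (toℕ-injective e))) ,
  s≤s (ℕ.≤-reflexive (toℕ-inject₁ j))

prev-not-between : ∀ {m} {i j : Fin (suc m)} → ¬ (i < prev i × prev i < j)
prev-not-between {i = zero}  {j} (_ , last<j) = ℕ.<⇒≱ last<j (≤fromℕ j)
prev-not-between {i = suc i}     (i<prev , _) = ℕ.<⇒≱ i<prev (ℕ.m≤n⇒m≤1+n (ℕ.≤-reflexive (toℕ-inject₁ i)))

<⇒prev≢ : ∀ {m} {i j : Fin (suc m)} → i < j → prev i ≢ i
<⇒prev≢ {i = zero}  {j} i<j e = ℕ.<⇒≱ i<j (subst (λ k → toℕ j ℕ.≤ toℕ k) e (≤fromℕ j))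
<⇒prev≢ {i = suc i}     _   e = ℕ.1+n≢n (sym (trans (sym (toℕ-inject₁ i)) (cong toℕ e)))

-- Noncrossing placements

-- The edge is the first one on which the walk leaves `Q`. Carrying `P` along lets the edge avoid a
-- deleted vertex.
walk-crosses : ∀ {n} {G : Graph n} {P Q : Fin n → Set} → Decidable Q → ∀ {x y} → Walk G P x y → Q x → ¬ Q y →
  ∃ λ a → ∃ λ b → P a × P b × Q a × ¬ Q b × adj G a b ≡ true
walk-crosses Q? (here _) qx ¬qy = contradiction qx ¬qy
walk-crosses {G = G} {P} {Q} Q? (step {v = z} px xz walk) qx ¬qy with Q? z
... | yes qz = walk-crosses {G = G} {P} {Q} Q? walk qz ¬qy
... | no ¬qz = _ , z , px , start walk , qx , ¬qz , xz
  where
  start : ∀ {x y} → Walk G P x y → P x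
  start (here p)     = p
  start (step p _ _) = p

module _ {m} (G : Graph (suc (suc m))) where

  V : Set
  V = Fin (suc (suc m))

  Noncrossing : Permutation′ (suc (suc m)) → Set
  Noncrossing p = ∀ a b c d → adj G a b ≡ true → adj G c d ≡ true →
      ¬ Interleave G (p ⟨$⟩ʳ a) (p ⟨$⟩ʳ b) (p ⟨$⟩ʳ c) (p ⟨$⟩ʳ d)

  adj-swap : ∀ {u v} → adj G u v ≡ true → adj G v u ≡ true
  adj-swap {u} {v} e = trans (adj-sym G v u) e

  aut-noncrossing : ∀ {σ p} → IsAut G σ → Noncrossing p → Noncrossing (σ ∘ₚ p)
  aut-noncrossing {σ} aut nc a b c d ab cd =
    nc (σ ⟨$⟩ʳ a) (σ ⟨$⟩ʳ b) (σ ⟨$⟩ʳ c) (σ ⟨$⟩ʳ d) (trans (aut a b) ab) (trans (aut c d) cd)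

  rotate-noncrossing : ∀ {p} → Noncrossing p → Noncrossing (p ∘ₚ prev-permutation)
  rotate-noncrossing {p} nc a b c d ab cd (a<c , c<b , b<d)
    with prev-<⁻ a<c | prev-<⁻ c<b | prev-<⁻ b<d
  ... | _    , inj₂ c≡0 | c≢0 , _        | _ = c≢0 (cong toℕ c≡0)
  ... | _    , inj₁ _   | _ , inj₂ b≡0   | b≢0 , _ = b≢0 (cong toℕ b≡0)
  ... | _    , inj₁ a<c | _ , inj₁ c<b   | _ , inj₁ b<d = nc a b c d ab cd (a<c , c<b , b<d)
  -- Here `d` was first and wrapped round to the end. The earlier order was `d`, `a`, `c`, `b`, so
  -- the same two edges already crossed, with their roles exchanged and `cd` reversed.
  ... | a≢0  , inj₁ a<c | _ , inj₁ c<b   | _ , inj₂ d≡0 =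
    nc d c a b (adj-swap cd) ab (subst (λ i → toℕ i ℕ.< toℕ (p ⟨$⟩ʳ a)) (sym d≡0) (ℕ.n≢0⇒n>0 a≢0) , a<c , c<b)

  -- Stands for the rotation of `p` that brings `v` to the front. The only link to `p` kept is
  -- `prev-preserved`, which suffices to transfer statements about neighbouring positions.
  record RotatedTo (p : Permutation′ (suc (suc m))) (v : V) : Set where
    field
      placement      : Permutation′ (suc (suc m))
      noncrossing    : Noncrossing placement
      first          : placement ⟨$⟩ʳ v ≡ zero
      prev-preserved : ∀ {x y} → prev (p ⟨$⟩ʳ y) ≡ p ⟨$⟩ʳ x → prev (placement ⟨$⟩ʳ y) ≡ placement ⟨$⟩ʳ x

  rotate-to : ∀ p → Noncrossing p → ∀ v → RotatedTo p v
  rotate-to p nc v = go (toℕ (p ⟨$⟩ʳ v)) p nc refl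
    where
    go : ∀ k p → Noncrossing p → toℕ (p ⟨$⟩ʳ v) ≡ k → RotatedTo p v
    go zero    p nc e = record
      { placement = p ; noncrossing = nc ; first = toℕ-injective e ; prev-preserved = λ e → e }
    go (suc k) p nc e = record
      { RotatedTo rotated using (placement; noncrossing; first)
      ; prev-preserved = λ e → RotatedTo.prev-preserved rotated (cong prev e) }
      where
      toℕ-prev : ∀ (i : V) → toℕ i ≡ suc k → toℕ (prev i) ≡ k
      toℕ-prev (suc i) e = trans (toℕ-inject₁ i) (ℕ.suc-injective e)
      rotated : RotatedTo (p ∘ₚ prev-permutation) v
      rotated = go k (p ∘ₚ prev-permutation) (rotate-noncrossing {p} nc) (toℕ-prev (p ⟨$⟩ʳ v) e)

  adj-irreflexive : ∀ {u v} → adj G u v ≡ true → u ≢ v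
  adj-irreflexive {u} e refl with trans (sym e) (adj-irr G u)
  ... | ()

  module _ (2-connected : TwoConnected G) where

    -- If x is the first neighbour of the last vertex u, deleting x leaves an
    -- edge jumping over x, which would cross the chord xu.
    first-last-adjacent : ∀ {p} → Noncrossing p → ∀ {u v} → p ⟨$⟩ʳ v ≡ zero → p ⟨$⟩ʳ u ≡ fromℕ _ →
      adj G u v ≡ true
    first-last-adjacent {p} nc {u} {v} pv pu with adj G u v Bool.≟ true
    ... | yes uv = uv
    ... | no ¬uv = contradiction (proj₁ (proj₂ 2-connected) u v) isolated
      where
      u≢v : u ≢ v
      u≢v refl with trans (sym pv) pu
      ... | ()

      no-neighbour : ∀ k x → toℕ (p ⟨$⟩ʳ x) ℕ.≤ k → adj G u x ≢ true
      no-neighbour zero x x≤0 ux =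
        ¬uv (subst (λ y → adj G u y ≡ true) (⟨$⟩ʳ-injective p (trans (toℕ-injective (ℕ.n≤0⇒n≡0 x≤0)) (sym pv))) ux)
      no-neighbour (suc k) x x≤1+k ux with walk-crosses {G = G}
             (λ y → (p ⟨$⟩ʳ y) <? (p ⟨$⟩ʳ x))
             (proj₂ (proj₂ 2-connected) x v u v≢x (adj-irreflexive ux)) v<x u≮x
        where
        v≢x : v ≢ x
        v≢x refl = ¬uv ux
        v<x : (p ⟨$⟩ʳ v) < (p ⟨$⟩ʳ x)
        v<x = ℕ.≤∧≢⇒< (subst (λ i → toℕ i ℕ.≤ toℕ (p ⟨$⟩ʳ x)) (sym pv) z≤n) (v≢x ∘ ⟨$⟩ʳ-injective p ∘ toℕ-injective)
        u≮x : ¬ (p ⟨$⟩ʳ u) < (p ⟨$⟩ʳ x)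
        u≮x u<x = ℕ.<⇒≱ u<x (subst (λ i → toℕ (p ⟨$⟩ʳ x) ℕ.≤ toℕ i) (sym pu) (≤fromℕ (p ⟨$⟩ʳ x)))
      ... | a , b , a≢x , b≢x , a<x , b≮x , ab = nc a b x u ab (adj-swap ux) (a<x , x<b , b<u)
        where
        x<b : (p ⟨$⟩ʳ x) < (p ⟨$⟩ʳ b)
        x<b = ℕ.≤∧≢⇒< (ℕ.≮⇒≥ b≮x) (λ e → b≢x (sym (⟨$⟩ʳ-injective p (toℕ-injective e))))
        -- Otherwise `a` would be a neighbour of `u` placed before `x`, which the induction on the
        -- bound `k` excludes.
        b≢u : b ≢ u
        b≢u refl = no-neighbour k a (ℕ.≤-pred (ℕ.≤-trans a<x x≤1+k)) (adj-swap ab)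
        b<u : (p ⟨$⟩ʳ b) < (p ⟨$⟩ʳ u)
        b<u = ℕ.≤∧≢⇒< (subst (λ i → toℕ (p ⟨$⟩ʳ b) ℕ.≤ toℕ i) (sym pu) (≤fromℕ _))
                      (b≢u ∘ ⟨$⟩ʳ-injective p ∘ toℕ-injective)

      isolated : ¬ Walk G _ u v
      isolated (here _)               = u≢v refl
      isolated (step {v = x} _ ux _) = no-neighbour (toℕ (p ⟨$⟩ʳ x)) x ℕ.≤-refl ux

    -- Rotating so that `v` comes first makes `u` last.
    prev-adjacent : ∀ {p} → Noncrossing p → ∀ {u v} → prev (p ⟨$⟩ʳ v) ≡ p ⟨$⟩ʳ u → adj G u v ≡ true
    prev-adjacent {p} nc {u} {v} e = first-last-adjacent {placement} noncrossing first
        (trans (sym (prev-preserved e)) (cong prev first))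
      where open RotatedTo (rotate-to p nc v)

    -- Connectedness of the graph with `u` and `v` deleted, phrased through edge-closed predicates
    -- so that it applies directly to a set of vertices cut off by a chord. It mentions no
    -- placement, and so can carry information from one placement to another.
    ConnectedAvoiding : V → V → Set₁
    ConnectedAvoiding u v = ∀ (Q : V → Set) →
      (∀ {x y} → x ≢ u → x ≢ v → y ≢ u → y ≢ v → adj G x y ≡ true → Q x → Q y) →
      ∀ {x y} → x ≢ u → x ≢ v → y ≢ u → y ≢ v → Q x → Q y

    connected-avoiding-swap : ∀ {u v} → ConnectedAvoiding u v → ConnectedAvoiding v u
    connected-avoiding-swap connected Q closed xv xu yv yu =
      connected Q (λ xu xv yu yv → closed xv xu yv yu) xu xv yu yv

    -- The vertices strictly between u and v would be separated from the others.
    ordered-consecutive : ∀ {p} → Noncrossing p → ∀ {u v} → adj G u v ≡ true → (p ⟨$⟩ʳ u) < (p ⟨$⟩ʳ v) →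
      ConnectedAvoiding u v → Consecutive (p ⟨$⟩ʳ u) (p ⟨$⟩ʳ v)
    ordered-consecutive {p} nc {u} {v} uv u<v connected with prev (p ⟨$⟩ʳ v) ≟ (p ⟨$⟩ʳ u) | prev (p ⟨$⟩ʳ u) ≟ (p ⟨$⟩ʳ v)
    ... | yes e | _      = inj₁ e
    ... | no _  | yes e  = inj₂ e
    -- The test vertices are the predecessors of `v` and of `u` on the circle: the first lies
    -- strictly between `u` and `v`, the second does not, and neither is `u` or `v`.
    ... | no ≢u | no ≢v  = contradiction (connected Between between-closed
            (avoids inner-between .proj₁) (avoids inner-between .proj₂)
            (λ e → <⇒prev≢ u<v (trans (sym (inverseʳ p)) (cong (p ⟨$⟩ʳ_) e)))
            (λ e → ≢v (trans (sym (inverseʳ p)) (cong (p ⟨$⟩ʳ_) e)))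
            inner-between)
            (λ between → prev-not-between (subst (λ i → (p ⟨$⟩ʳ u) < i × i < (p ⟨$⟩ʳ v)) (inverseʳ p) between))
      where
      Between : V → Set
      Between x = (p ⟨$⟩ʳ u) < (p ⟨$⟩ʳ x) × (p ⟨$⟩ʳ x) < (p ⟨$⟩ʳ v)
      avoids : ∀ {x} → Between x → x ≢ u × x ≢ v
      avoids (u<x , x<v) = (λ { refl → ℕ.<-irrefl refl u<x }) , (λ { refl → ℕ.<-irrefl refl x<v })
      inner-between : Between (p ⟨$⟩ˡ prev (p ⟨$⟩ʳ v))
      inner-between = subst (λ i → (p ⟨$⟩ʳ u) < i × i < (p ⟨$⟩ʳ v)) (sym (inverseʳ p)) (prev-between u<v ≢u)
      between-closed : ∀ {x y} → x ≢ u → x ≢ v → y ≢ u → y ≢ v → adj G x y ≡ true → Between x → Between y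
      between-closed {x} {y} _ _ y≢u y≢v xy (u<x , x<v)
        with <-cmp (p ⟨$⟩ʳ u) (p ⟨$⟩ʳ y) | <-cmp (p ⟨$⟩ʳ y) (p ⟨$⟩ʳ v)
      ... | tri< u<y _ _ | tri< y<v _ _ = u<y , y<v
      ... | tri> _ _ y<u | _            = contradiction (y<u , u<x , x<v) (nc y x u v (adj-swap xy) uv)
      ... | tri≈ _ e _   | _            = contradiction (sym (⟨$⟩ʳ-injective p e)) y≢u
      ... | _            | tri≈ _ e _   = contradiction (⟨$⟩ʳ-injective p e) y≢v
      ... | _            | tri> _ _ v<y = contradiction (u<x , x<v , v<y) (nc u v x y uv xy)

    avoiding-connected⇒consecutive : ∀ {p} → Noncrossing p → ∀ {u v} → adj G u v ≡ true →
      ConnectedAvoiding u v → Consecutive (p ⟨$⟩ʳ u) (p ⟨$⟩ʳ v)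
    avoiding-connected⇒consecutive {p} nc {u} {v} uv connected with <-cmp (p ⟨$⟩ʳ u) (p ⟨$⟩ʳ v)
    ... | tri< u<v _ _ = ordered-consecutive {p} nc uv u<v connected
    ... | tri≈ _ e _   = contradiction (⟨$⟩ʳ-injective p e) (adj-irreflexive uv)
    ... | tri> _ _ v<u = Sum.swap (ordered-consecutive {p} nc (adj-swap uv) v<u (connected-avoiding-swap connected))

    -- Deleting two neighbours from the Hamilton cycle leaves a path. With `v` first and `u` last,
    -- this path runs through the positions in between, starting at `second`.
    prev⇒connected-avoiding : ∀ {p} → Noncrossing p → ∀ {u v} → prev (p ⟨$⟩ʳ v) ≡ p ⟨$⟩ʳ u → ConnectedAvoiding u v
    prev⇒connected-avoiding {p} nc {u} {v} e Q closed xu xv yu yv Qx =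
      proj₂ (via-second yu yv) (proj₁ (via-second xu xv) Qx)
      where
      open RotatedTo (rotate-to p nc v)
      vertex : V → V
      vertex = placement ⟨$⟩ˡ_
      vertex-of : ∀ {x} → vertex (placement ⟨$⟩ʳ x) ≡ x
      vertex-of = inverseˡ placement
      u-last : fromℕ (suc m) ≡ placement ⟨$⟩ʳ u
      u-last = trans (cong prev (sym first)) (prev-preserved e)
      ≢v : ∀ {i} → vertex (suc i) ≢ v
      ≢v e with trans (sym first) (trans (cong (placement ⟨$⟩ʳ_) (sym e)) (inverseʳ placement))
      ... | ()
      ≢u : ∀ {i} → suc i ≢ fromℕ (suc m) → vertex (suc i) ≢ u
      ≢u i≢last e = i≢last (trans (sym (inverseʳ placement)) (trans (cong (placement ⟨$⟩ʳ_) e) (sym u-last)))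

      -- In a graph on two vertices this is `u` itself, which is harmless because then no vertex
      -- avoids both `u` and `v`.
      second : V
      second = vertex (suc zero)

      along : ∀ k (i : Fin (suc m)) → toℕ i ≡ k → suc i ≢ fromℕ (suc m) →
        (Q (vertex (suc i)) → Q second) × (Q second → Q (vertex (suc i)))
      along _       zero    _ _      = (λ q → q) , (λ q → q)
      along (suc k) (suc j) e i≢last =
        (λ q → proj₁ below (closed (≢u i≢last) ≢v (≢u j≢last) ≢v (adj-swap edge) q)) ,
        (λ q → closed (≢u j≢last) ≢v (≢u i≢last) ≢v edge (proj₂ below q))
        where
        j≢last : suc (inject₁ j) ≢ fromℕ (suc m)
        j≢last e = fromℕ≢inject₁ (sym (suc-injective e))
        below : (Q (vertex (suc (inject₁ j))) → Q second) × (Q second → Q (vertex (suc (inject₁ j))))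
        below = along k (inject₁ j) (trans (toℕ-inject₁ j) (ℕ.suc-injective e)) j≢last
        edge : adj G (vertex (suc (inject₁ j))) (vertex (suc (suc j))) ≡ true
        edge = prev-adjacent {placement} noncrossing (trans (cong prev (inverseʳ placement)) (sym (inverseʳ placement)))

      via-second : ∀ {x} → x ≢ u → x ≢ v → (Q x → Q second) × (Q second → Q x)
      via-second {x} x≢u x≢v with placement ⟨$⟩ʳ x in eq
      ... | zero  = contradiction (⟨$⟩ʳ-injective placement (trans eq (sym first))) x≢v
      ... | suc i = subst (λ y → (Q y → Q second) × (Q second → Q y))
              (trans (cong vertex (sym eq)) vertex-of)
              (along (toℕ i) i refl (λ e → x≢u (⟨$⟩ʳ-injective placement (trans eq (trans e u-last)))))

    placement-unique : ∀ {p q v} → Noncrossing p → Noncrossing q → p ⟨$⟩ʳ v ≡ zero → q ⟨$⟩ʳ v ≡ zero →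
      (∀ x → p ⟨$⟩ʳ x ≡ q ⟨$⟩ʳ x) ⊎ (∀ x → p ⟨$⟩ʳ x ≡ neg (q ⟨$⟩ʳ x))
    placement-unique {p} {q} {v} p-nc q-nc pv qv = Sum.map
        (λ h x → trans (sym (g-of x)) (h (q ⟨$⟩ʳ x)))
        (λ h x → trans (sym (g-of x)) (h (q ⟨$⟩ʳ x)))
        (consecutive⇒identity∨neg g
          (λ e → ⟨$⟩ʳ-injective (flip q) (⟨$⟩ʳ-injective p e))
          (trans (trans (cong g (sym qv)) (g-of v)) pv)
          g-consecutive)
      where
      g : V → V
      g i = p ⟨$⟩ʳ (q ⟨$⟩ˡ i)
      g-of : ∀ x → g (q ⟨$⟩ʳ x) ≡ p ⟨$⟩ʳ x
      g-of x = cong (p ⟨$⟩ʳ_) (inverseˡ q)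
      g-consecutive : ∀ i → Consecutive (g (inject₁ i)) (g (suc i))
      g-consecutive i = avoiding-connected⇒consecutive {p} p-nc (prev-adjacent {q} q-nc e)
          (prev⇒connected-avoiding {q} q-nc e)
        where
        e : prev (q ⟨$⟩ʳ (q ⟨$⟩ˡ suc i)) ≡ q ⟨$⟩ʳ (q ⟨$⟩ˡ inject₁ i)
        e = trans (cong prev (inverseʳ q)) (sym (inverseʳ q))

-- Exchange in a permutation group whose point stabilisers have order at most two

x∈p─q⇒x∉q : ∀ {n} {p q : Subset n} {x} → x ∈ p ─ q → x ∉ q
x∈p─q⇒x∉q {p = _ ∷ p} {inside  ∷ q} (there x∈) (there x∈q) = x∈p─q⇒x∉q {p = p} x∈ x∈q
x∈p─q⇒x∉q {p = _ ∷ p} {outside ∷ q} (there x∈) (there x∈q) = x∈p─q⇒x∉q {p = p} x∈ x∈q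

exchanged⁻ : ∀ {n} {S : Subset n} {s r x} → x ∈ (S - s) ∪ ⁅ r ⁆ → (x ∈ S × x ≢ s) ⊎ x ≡ r
exchanged⁻ {S = S} {s} {r} x∈ with x∈p∪q⁻ (S - s) ⁅ r ⁆ x∈
... | inj₁ x∈S-s = inj₁ (p─q⊆p S ⁅ s ⁆ x∈S-s , λ { refl → x∈p─q⇒x∉q {p = S} x∈S-s (x∈⁅x⁆ s) })
... | inj₂ x∈⁅r⁆ = inj₂ (x∈⁅y⁆⇒x≡y r x∈⁅r⁆)

kept∈exchanged : ∀ {n} {S : Subset n} {s r x} → x ∈ S → x ≢ s → x ∈ (S - s) ∪ ⁅ r ⁆
kept∈exchanged x∈S x≢s = x∈p∪q⁺ (inj₁ (x∈p∧x≢y⇒x∈p-y x∈S x≢s))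

new∈exchanged : ∀ {n} {S : Subset n} {s r} → r ∈ (S - s) ∪ ⁅ r ⁆
new∈exchanged {r = r} = x∈p∪q⁺ (inj₂ (x∈⁅x⁆ r))

∈pair⁻ : ∀ {n} {u w y : Fin n} → y ∈ ⁅ u ⁆ ∪ ⁅ w ⁆ → y ≡ u ⊎ y ≡ w
∈pair⁻ {u = u} {w} y∈ = Sum.map (x∈⁅y⁆⇒x≡y u) (x∈⁅y⁆⇒x≡y w) (x∈p∪q⁻ ⁅ u ⁆ ⁅ w ⁆ y∈)

_≈?_ : ∀ {n} (σ τ : Permutation′ n) → Dec (σ ≈ τ)
σ ≈? τ = all? λ x → (σ ⟨$⟩ʳ x) ≟ (τ ⟨$⟩ʳ x)

identity? : ∀ {n} (G : Graph n) σ → Dec (IsIdentity G σ)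
identity? G σ = all? λ x → (σ ⟨$⟩ʳ x) ≟ x

isAut? : ∀ {n} (G : Graph n) σ → Dec (IsAut G σ)
isAut? G σ = all? λ u → all? λ v → adj G (σ ⟨$⟩ʳ u) (σ ⟨$⟩ʳ v) Bool.≟ adj G u v

determining-⊆ : ∀ {n} (G : Graph n) {S T} → S ⊆ T → Determining G S → Determining G T
determining-⊆ G S⊆T det σ aut fixes = det σ aut (λ v v∈S → fixes v (S⊆T v∈S))

module StabiliserOrder≤2 {n} (G : Graph n) (ρ : Fin n → Permutation′ n) (ρ-fixes : ∀ v → ρ v ⟨$⟩ʳ v ≡ v)
  (stabiliser : ∀ v τ → IsAut G τ → τ ⟨$⟩ʳ v ≡ v → IsIdentity G τ ⊎ τ ≈ ρ v) where

  -- `ρ v` is only a candidate for a nontrivial element of the stabiliser of `v`. `Mirror v` says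
  -- that this stabiliser is nontrivial, and its negation that every nonidentity automorphism moves
  -- `v`.
  Mirror : Fin n → Set
  Mirror v = IsAut G (ρ v) × ¬ IsIdentity G (ρ v)

  mirror? : Decidable Mirror
  mirror? v = isAut? G (ρ v) ×-dec ¬? (identity? G (ρ v))

  fixing⇒mirror : ∀ {τ v} → IsAut G τ → ¬ IsIdentity G τ → τ ⟨$⟩ʳ v ≡ v → Mirror v × τ ≈ ρ v
  fixing⇒mirror {τ} {v} aut ¬id fix with stabiliser v τ aut fix
  ... | inj₁ id  = contradiction id ¬id
  ... | inj₂ τ≈ρ =
    ((λ x y → trans (cong₂ (adj G) (sym (τ≈ρ x)) (sym (τ≈ρ y))) (aut x y)) ,
     (λ id → ¬id (λ x → trans (τ≈ρ x) (id x)))) , τ≈ρ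

  ρ≈⇒fixes : ∀ {u v} → ρ u ≈ ρ v → ρ u ⟨$⟩ʳ v ≡ v
  ρ≈⇒fixes {v = v} ρu≈ρv = trans (ρu≈ρv v) (ρ-fixes v)

  single-determining : ∀ {S v} → ¬ Mirror v → v ∈ S → Determining G S
  single-determining {v = v} ¬mirror v∈S σ aut fixes with identity? G σ
  ... | yes id = id
  ... | no ¬id = contradiction (proj₁ (fixing⇒mirror {σ} aut ¬id (fixes v v∈S))) ¬mirror

  -- A nonidentity automorphism fixing both vertices would equal both `ρ u` and `ρ w`.
  pair-determining : ∀ {S u w} → ¬ ρ u ≈ ρ w → u ∈ S → w ∈ S → Determining G S
  pair-determining {u = u} {w} ρu≉ρw u∈S w∈S σ aut fixes with identity? G σ
  ... | yes id = id
  ... | no ¬id = contradiction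
      (λ x → trans (sym (proj₂ (fixing⇒mirror {σ} aut ¬id (fixes u u∈S)) x)) (proj₂ (fixing⇒mirror {σ} aut ¬id (fixes w w∈S)) x))
      ρu≉ρw

  mirror-fixes⇒¬determining : ∀ {S v} → Mirror v → (∀ x → x ∈ S → ρ v ⟨$⟩ʳ x ≡ x) → ¬ Determining G S
  mirror-fixes⇒¬determining {v = v} (aut , ¬id) fixes det = ¬id (det (ρ v) aut fixes)

  -- A proper subset of a singleton is empty, so the empty set must be known not to determine.
  -- Describing `S` by its members lets the lemma apply to sets produced by an exchange.
  single-minimal : ∀ {S v} → ¬ Determining G ∅ → ¬ Mirror v → v ∈ S → (∀ {x} → x ∈ S → x ≡ v) →
    MinimalDetermining G S
  single-minimal {S} {v} ¬det∅ ¬mirror v∈S S⊆v = single-determining ¬mirror v∈S , minimal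
    where
    minimal : ∀ T → T ⊂ S → ¬ Determining G T
    minimal T (T⊆S , x , x∈S , x∉T) = ¬det∅ ∘ determining-⊆ G
      λ y∈T → contradiction (subst (_∈ T) (trans (S⊆v (T⊆S y∈T)) (sym (S⊆v x∈S))) y∈T) x∉T

  -- Once either vertex is dropped, the mirror of the other fixes all that remains.
  pair-minimal : ∀ {S u w} → Mirror u → Mirror w → ¬ ρ u ≈ ρ w → u ∈ S → w ∈ S →
    (∀ {x} → x ∈ S → x ≡ u ⊎ x ≡ w) → MinimalDetermining G S
  pair-minimal {S} {u} {w} mirror-u mirror-w ρu≉ρw u∈S w∈S S⊆uw = pair-determining ρu≉ρw u∈S w∈S , minimal
    where
    minimal : ∀ T → T ⊂ S → ¬ Determining G T
    minimal T (T⊆S , x , x∈S , x∉T) with S⊆uw x∈S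
    ... | inj₁ refl = mirror-fixes⇒¬determining mirror-w λ y y∈T → fixed y y∈T (S⊆uw (T⊆S y∈T))
      where
      fixed : ∀ y → y ∈ T → y ≡ u ⊎ y ≡ w → ρ w ⟨$⟩ʳ y ≡ y
      fixed y y∈T (inj₁ refl) = contradiction y∈T x∉T
      fixed y y∈T (inj₂ refl) = ρ-fixes y
    ... | inj₂ refl = mirror-fixes⇒¬determining mirror-u λ y y∈T → fixed y y∈T (S⊆uw (T⊆S y∈T))
      where
      fixed : ∀ y → y ∈ T → y ≡ u ⊎ y ≡ w → ρ u ⟨$⟩ʳ y ≡ y
      fixed y y∈T (inj₁ refl) = ρ-fixes y
      fixed y y∈T (inj₂ refl) = contradiction y∈T x∉T

  -- The singleton of `v` already determines, so a further member of `S` would make it a proper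
  -- determining subset.
  minimal⊆single : ∀ {S v} → MinimalDetermining G S → ¬ Mirror v → v ∈ S → ∀ {x} → x ∈ S → x ≡ v
  minimal⊆single {v = v} (_ , minimal) ¬mirror v∈S {x} x∈S with x ≟ v
  ... | yes x≡v = x≡v
  ... | no  x≢v = contradiction (single-determining ¬mirror (x∈⁅x⁆ v))
    (minimal ⁅ v ⁆ ((λ y∈ → subst (_∈ _) (sym (x∈⁅y⁆⇒x≡y v y∈)) v∈S) , x , x∈S , x≢v ∘ x∈⁅y⁆⇒x≡y v))

  minimal⊆pair : ∀ {S u w} → MinimalDetermining G S → ¬ ρ u ≈ ρ w → u ∈ S → w ∈ S →
    ∀ {x} → x ∈ S → x ≡ u ⊎ x ≡ w
  minimal⊆pair {S} {u} {w} (_ , minimal) ρu≉ρw u∈S w∈S {x} x∈S with x ≟ u | x ≟ w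
  ... | yes x≡u | _       = inj₁ x≡u
  ... | no _    | yes x≡w = inj₂ x≡w
  ... | no x≢u  | no x≢w  = contradiction
      (pair-determining ρu≉ρw (x∈p∪q⁺ (inj₁ (x∈⁅x⁆ u))) (x∈p∪q⁺ (inj₂ (x∈⁅x⁆ w))))
      (minimal pair ((λ y∈ → pair⊆S (∈pair⁻ y∈)) , x , x∈S , λ x∈ → Sum.[ x≢u , x≢w ] (∈pair⁻ x∈)))
    where
    pair : Subset n
    pair = ⁅ u ⁆ ∪ ⁅ w ⁆
    pair⊆S : ∀ {y} → y ≡ u ⊎ y ≡ w → y ∈ S
    pair⊆S (inj₁ refl) = u∈S
    pair⊆S (inj₂ refl) = w∈S

  exchange-pair : ∀ {S a b r} → Mirror a → Mirror r → ¬ ρ r ≈ ρ a → a ∈ S → a ≢ b →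
    (∀ {x} → x ∈ S → x ≡ a ⊎ x ≡ b) → MinimalDetermining G ((S - b) ∪ ⁅ r ⁆)
  exchange-pair {S} {a} {b} {r} mirror-a mirror-r ρr≉ρa a∈S a≢b S⊆ab =
    pair-minimal mirror-a mirror-r (λ e → ρr≉ρa (sym ∘ e)) (kept∈exchanged a∈S a≢b) (new∈exchanged {S = S})
      (λ x∈ → among (exchanged⁻ {S = S} x∈))
    where
    among : ∀ {x} → (x ∈ S × x ≢ b) ⊎ x ≡ r → x ≡ a ⊎ x ≡ r
    among (inj₂ x≡r) = inj₂ x≡r
    among (inj₁ (x∈S , x≢b)) with S⊆ab x∈S
    ... | inj₁ x≡a = inj₁ x≡a
    ... | inj₂ x≡b = contradiction x≡b x≢b

  -- Every minimal determining set is then a pair with different mirrors. The mirror of `r` agrees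
  -- with at most one of them, and that member is the one to discard.
  all-mirrors⇒exchange : (∀ v → Mirror v) → ExchangeProperty G
  all-mirrors⇒exchange mirror S R S-min R-min r r∈R
    with any? (λ a → any? (λ b → (a ∈? S) ×-dec (b ∈? S) ×-dec ¬? (ρ a ≈? ρ b)))
  ... | yes (a , b , a∈S , b∈S , ρa≉ρb) = exchange (ρ r ≈? ρ a)
    where
    S⊆ab : ∀ {x} → x ∈ S → x ≡ a ⊎ x ≡ b
    S⊆ab = minimal⊆pair S-min ρa≉ρb a∈S b∈S
    a≢b : a ≢ b
    a≢b refl = ρa≉ρb (λ _ → refl)
    exchange : Dec (ρ r ≈ ρ a) → ∃ λ s → s ∈ S × MinimalDetermining G ((S - s) ∪ ⁅ r ⁆)
    exchange (no ρr≉ρa)  = b , b∈S , exchange-pair (mirror a) (mirror r) ρr≉ρa a∈S a≢b S⊆ab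
    exchange (yes ρr≈ρa) = a , a∈S , exchange-pair (mirror b) (mirror r)
      (λ ρr≈ρb → ρa≉ρb (λ x → trans (sym (ρr≈ρa x)) (ρr≈ρb x))) b∈S (a≢b ∘ sym) (Sum.swap ∘ S⊆ab)
  ... | no none = contradiction (proj₁ S-min) (not-determining (any? (_∈? S)))
    where
    not-determining : Dec (∃ λ a → a ∈ S) → ¬ Determining G S
    -- An empty `S` offers no mirror of its own, so the one of `r` is used.
    not-determining (no empty) = mirror-fixes⇒¬determining (mirror r) λ x x∈S → contradiction (x , x∈S) empty
    not-determining (yes (a , a∈S)) = mirror-fixes⇒¬determining (mirror a) fixed
      where
      fixed : ∀ x → x ∈ S → ρ a ⟨$⟩ʳ x ≡ x
      fixed x x∈S with ρ a ≈? ρ x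
      ... | yes ρa≈ρx = ρ≈⇒fixes ρa≈ρx
      ... | no ρa≉ρx  = contradiction (a , x , a∈S , x∈S , ρa≉ρx) none

  -- If all mirrors coincide, members of minimal determining sets have trivial stabilisers. Such
  -- sets are singletons here, and any one can replace any other.
  one-mirror⇒exchange : (∀ u w → Mirror u → Mirror w → ρ u ≈ ρ w) → ExchangeProperty G
  one-mirror⇒exchange ρ≈ρ S R S-min R-min r r∈R = exchange (moved R-min r∈R) S-nonempty
    where
    ¬det∅ : ¬ Determining G ∅
    ¬det∅ = proj₂ R-min ∅ (⊥⊆ , r , r∈R , ∉⊥)

    moved : ∀ {T t} → MinimalDetermining G T → t ∈ T → ¬ Mirror t
    moved {T} {t} T-min t∈T mirror-t = mirror-fixes⇒¬determining mirror-t fixed (proj₁ T-min)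
      where
      fixed : ∀ x → x ∈ T → ρ t ⟨$⟩ʳ x ≡ x
      fixed x x∈T with mirror? x
      ... | yes mirror-x = ρ≈⇒fixes (ρ≈ρ t x mirror-t mirror-x)
      -- By minimality such an `x` is the only member of `T`, so `t` equals `x` and is fixed by its
      -- own mirror.
      ... | no ¬mirror-x = subst (λ y → ρ t ⟨$⟩ʳ y ≡ y) (minimal⊆single T-min ¬mirror-x x∈T t∈T) (ρ-fixes t)

    S-nonempty : ∃ λ s → s ∈ S
    S-nonempty with any? (_∈? S)
    ... | yes s∈S  = s∈S
    ... | no empty = contradiction (determining-⊆ G (λ x∈S → contradiction (_ , x∈S) empty) (proj₁ S-min)) ¬det∅

    exchange : ¬ Mirror r → (∃ λ s → s ∈ S) → ∃ λ s → s ∈ S × MinimalDetermining G ((S - s) ∪ ⁅ r ⁆)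
    exchange ¬mirror-r (s , s∈S) = s , s∈S , single-minimal ¬det∅ ¬mirror-r (new∈exchanged {S = S})
      (λ x∈ → among (exchanged⁻ {S = S} x∈))
      where
      among : ∀ {x} → (x ∈ S × x ≢ s) ⊎ x ≡ r → x ≡ r
      among (inj₂ x≡r) = x≡r
      among (inj₁ (x∈S , x≢s)) = contradiction (minimal⊆single S-min (moved S-min s∈S) s∈S x∈S) x≢s

  mixed⇒¬exchange : ∀ {u v w} → ¬ Mirror v → Mirror u → Mirror w → ¬ ρ u ≈ ρ w → ¬ ExchangeProperty G
  mixed⇒¬exchange {u} {v} {w} ¬mirror-v mirror-u mirror-w ρu≉ρw exchange =
    refute (exchange pair ⁅ v ⁆
      (pair-minimal mirror-u mirror-w ρu≉ρw u∈ w∈ ∈pair⁻)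
      (single-minimal (mirror-fixes⇒¬determining mirror-u λ _ x∈∅ → contradiction x∈∅ ∉⊥) ¬mirror-v (x∈⁅x⁆ v) (x∈⁅y⁆⇒x≡y v))
      v (x∈⁅x⁆ v))
    where
    pair : Subset n
    pair = ⁅ u ⁆ ∪ ⁅ w ⁆
    u∈ : u ∈ pair
    u∈ = x∈p∪q⁺ (inj₁ (x∈⁅x⁆ u))
    w∈ : w ∈ pair
    w∈ = x∈p∪q⁺ (inj₂ (x∈⁅x⁆ w))

    not-minimal : ∀ {s x} → x ∈ pair → x ≢ s → Mirror x → ¬ MinimalDetermining G ((pair - s) ∪ ⁅ v ⁆)
    not-minimal {s} x∈ x≢s mirror-x min = ¬mirror-v (subst Mirror
      (minimal⊆single min ¬mirror-v (new∈exchanged {S = pair}) (kept∈exchanged x∈ x≢s)) mirror-x)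

    refute : ¬ (∃ λ s → s ∈ pair × MinimalDetermining G ((pair - s) ∪ ⁅ v ⁆))
    refute (s , s∈ , min) with ∈pair⁻ s∈
    ... | inj₁ refl = not-minimal w∈ (λ { refl → ρu≉ρw (λ _ → refl) }) mirror-w min
    ... | inj₂ refl = not-minimal u∈ (λ { refl → ρu≉ρw (λ _ → refl) }) mirror-u min

-- Vertex stabilisers and reflections of an outerplanar graph.

module _ {m} (G : Graph (suc (suc m))) (2-connected : TwoConnected G)
  (p : Permutation′ (suc (suc m))) (nc : Noncrossing G p) where

  from : Fin (suc (suc m)) → Permutation′ (suc (suc m))
  from v = RotatedTo.placement (rotate-to G p nc v)

  -- The reflection of the circle through `v`, transported to vertices. It need not be an
  -- automorphism of `G`.
  mirror-at : Fin (suc (suc m)) → Permutation′ (suc (suc m))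
  mirror-at v = from v ∘ₚ neg-permutation ∘ₚ flip (from v)

  mirror-at-fixes : ∀ v → mirror-at v ⟨$⟩ʳ v ≡ v
  mirror-at-fixes v = trans (cong (from v ⟨$⟩ˡ_) (trans (cong neg first) (sym first))) (inverseˡ (from v))
    where open RotatedTo (rotate-to G p nc v)

  -- Composing the placement with `τ` gives another noncrossing placement with `v` first, so
  -- uniqueness up to `neg` applies.
  fixing⇒identity∨mirror : ∀ v τ → IsAut G τ → τ ⟨$⟩ʳ v ≡ v → IsIdentity G τ ⊎ τ ≈ mirror-at v
  fixing⇒identity∨mirror v τ aut fix = Sum.map
      (λ h x → ⟨$⟩ʳ-injective (from v) (h x))
      (λ h x → trans (sym (inverseˡ (from v))) (cong (from v ⟨$⟩ˡ_) (h x)))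
      (placement-unique G 2-connected {τ ∘ₚ from v} {from v} (aut-noncrossing G {τ} {from v} aut noncrossing) noncrossing
        (trans (cong (from v ⟨$⟩ʳ_) fix) first) first)
    where open RotatedTo (rotate-to G p nc v)

  -- The placement read from positions to vertices is a Hamilton cycle. The reflection has index
  -- `zero` because the fixed vertex `v` sits at position zero.
  fixing⇒reflection : ∀ {v τ} → IsAut G τ → ¬ IsIdentity G τ → τ ⟨$⟩ʳ v ≡ v → IsReflection G τ
  fixing⇒reflection {v} {τ} aut ¬id fix = aut , ¬id , flip (from v) , hamiltonian , zero , reflects
    where
    open RotatedTo (rotate-to G p nc v)
    hamiltonian : IsHamiltonCycle G (flip (from v))
    hamiltonian i = prev-adjacent G 2-connected {from v} noncrossing
      (trans (cong prev (inverseʳ (from v))) (trans (prev-modF-suc i) (sym (inverseʳ (from v)))))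
    reflects : ∀ i → τ ⟨$⟩ʳ (from v ⟨$⟩ˡ i) ≡ from v ⟨$⟩ˡ reflectPos zero i
    reflects i with fixing⇒identity∨mirror v τ aut fix
    ... | inj₁ id = contradiction id ¬id
    ... | inj₂ τ≈ = trans (τ≈ (from v ⟨$⟩ˡ i))
      (cong (from v ⟨$⟩ˡ_) (trans (cong neg (inverseʳ (from v))) (neg≡reflectPos i)))

theorem18 : ∀ {n} (G : Graph n) → TwoConnected G → Outerplanar G →
  ((¬ ExchangeProperty G) ⇔
    ((∃ λ (v : Fin n) → ∀ σ → IsReflection G σ → σ ⟨$⟩ʳ v ≢ v)
     × (∃ λ (u : Fin n) → ∃ λ (w : Fin n) → ∃ λ (σ : Permutation′ n) → ∃ λ (τ : Permutation′ n) →
          u ≢ w × IsReflection G σ × IsReflection G τ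
          × (¬ (∀ x → σ ⟨$⟩ʳ x ≡ τ ⟨$⟩ʳ x))
          × σ ⟨$⟩ʳ u ≡ u × τ ⟨$⟩ʳ w ≡ w)))
theorem18 {zero}        G (() , _)
theorem18 {suc zero}    G (s≤s () , _)
theorem18 {suc (suc m)} G 2-connected (p , nc) = mk⇔ (λ ¬exchange → some-moved ¬exchange , two-fixed ¬exchange) back
  where
  open StabiliserOrder≤2 G (mirror-at G 2-connected p nc) (mirror-at-fixes G 2-connected p nc)
    (fixing⇒identity∨mirror G 2-connected p nc)

  ρ : Fin (suc (suc m)) → Permutation′ (suc (suc m))
  ρ = mirror-at G 2-connected p nc

  MovedByReflections : Fin (suc (suc m)) → Set
  MovedByReflections v = ∀ σ → IsReflection G σ → σ ⟨$⟩ʳ v ≢ v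

  ρ-reflection : ∀ {v} → Mirror v → IsReflection G (ρ v)
  ρ-reflection {v} (aut , ¬id) = fixing⇒reflection G 2-connected p nc {v} {ρ v} aut ¬id (mirror-at-fixes G 2-connected p nc v)

  some-moved : ¬ ExchangeProperty G → ∃ MovedByReflections
  -- A finite search over the decidable `Mirror` extracts an actual vertex from the mere refutation
  -- of exchange.
  some-moved ¬exchange with any? (¬? ∘ mirror?)
  ... | yes (v , ¬mirror) = v , λ σ (aut , ¬id , _) fix → ¬mirror (proj₁ (fixing⇒mirror {σ} aut ¬id fix))
  ... | no none = contradiction
      (all-mirrors⇒exchange λ v → decidable-stable (mirror? v) λ ¬mirror → none (v , ¬mirror)) ¬exchange

  TwoFixed : Set
  TwoFixed = ∃ λ u → ∃ λ w → ∃ λ σ → ∃ λ τ → u ≢ w × IsReflection G σ × IsReflection G τ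
    × (¬ (∀ x → σ ⟨$⟩ʳ x ≡ τ ⟨$⟩ʳ x)) × σ ⟨$⟩ʳ u ≡ u × τ ⟨$⟩ʳ w ≡ w

  two-fixed : ¬ ExchangeProperty G → TwoFixed
  two-fixed ¬exchange
    with any? (λ u → any? (λ w → mirror? u ×-dec mirror? w ×-dec ¬? (ρ u ≈? ρ w)))
  ... | yes (u , w , mirror-u , mirror-w , ρu≉ρw) =
    u , w , ρ u , ρ w , (λ { refl → ρu≉ρw (λ _ → refl) }) , ρ-reflection mirror-u , ρ-reflection mirror-w ,
    ρu≉ρw , mirror-at-fixes G 2-connected p nc u , mirror-at-fixes G 2-connected p nc w
  ... | no none = contradiction
      (one-mirror⇒exchange λ u w mirror-u mirror-w → decidable-stable (ρ u ≈? ρ w)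
        λ ρu≉ρw → none (u , w , mirror-u , mirror-w , ρu≉ρw)) ¬exchange

  -- A reflection fixing `u` must be `ρ u`, and one fixing `w` must be `ρ w`; so different
  -- reflections give different mirrors.
  back : ∃ MovedByReflections × TwoFixed → ¬ ExchangeProperty G
  back ((v , moved) , u , w , σ , τ , _ , (σ-aut , σ-¬id , _) , (τ-aut , τ-¬id , _) , σ≉τ , σ-fixes , τ-fixes) =
    mixed⇒¬exchange {u} {v} {w} (λ mirror-v → moved (ρ v) (ρ-reflection mirror-v) (mirror-at-fixes G 2-connected p nc v))
      (proj₁ σ-mirror) (proj₁ τ-mirror)
      (λ ρu≈ρw → σ≉τ λ x → trans (proj₂ σ-mirror x) (trans (ρu≈ρw x) (sym (proj₂ τ-mirror x))))
    where
    σ-mirror : Mirror u × σ ≈ ρ u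
    σ-mirror = fixing⇒mirror {σ} σ-aut σ-¬id σ-fixes
    τ-mirror : Mirror w × τ ≈ ρ w
    τ-mirror = fixing⇒mirror {τ} τ-aut τ-¬id τ-fixes
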